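{- There is a constant $c>0$ such that, if $G$ is chosen uniformly at random from the set $\mathcal{G}_{n,n}$ of all $2^{n^2}$ bipartite graphs with fixed labelled partite sets $V_1,V_2$, $|V_1|=|V_2|=n$, then with probability tending to $1$ as $n\to\infty$, $f_{\min}(G)\ge cn/\log n$.
   Context: For a graph $G$ and a positive integer $k$, a $k$-min-difference representation of $G$ is an assignment of a finite set $A_i$ to each vertex $i$ such that for distinct vertices $i,j$: $ij\in E(G)$ if and only if $\min\{|A_i\setminus A_j|,|A_j\setminus A_i|\}\ge k$. $f_{\min}(G)$ denotes the smallest $k$ such that $G$ has a $k$-min-difference representation. -}

module Defs where

open import Data.Bool using (Bool; true; false)
open import Data.Nat using (ℕ; zero; suc; _+_; _*_; _∸_; _^_; _≤_; _≥_; _<_; _⊔_; _⊓_)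
open import Data.Nat.Logarithm using (⌊log₂_⌋)
open import Data.Fin using (Fin)
open import Data.Fin.Subset using (Subset; _─_; ∣_∣)
open import Data.Sum using (_⊎_; inj₁; inj₂)
open import Data.Product using (Σ; ∃; _×_; _,_)
open import Data.List using (List; length)
open import Data.List.Relation.Unary.All using (All)
open import Data.List.Relation.Unary.Unique.Propositional using (Unique)
open import Relation.Binary.PropositionalEquality using (_≡_; _≢_)
open import Relation.Nullary using (¬_)
open import Function.Bundles using (_⇔_)

-- A bipartite graph with labelled partite sets V₁ = V₂ = Fin n, given by its
-- biadjacency matrix: B i j = true iff i ∈ V₁ is adjacent to j ∈ V₂.
-- There are exactly 2^(n²) such graphs.
BipGraph : ℕ → Set
BipGraph n = Fin n → Fin n → Bool

Vertex : ℕ → Set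
Vertex n = Fin n ⊎ Fin n

adj : ∀ {n} → BipGraph n → Vertex n → Vertex n → Bool
adj B (inj₁ i) (inj₂ j) = B i j
adj B (inj₂ j) (inj₁ i) = B i j
adj B (inj₁ _) (inj₁ _) = false
adj B (inj₂ _) (inj₂ _) = false

IsMinDiffRep : ∀ {n m} → BipGraph n → ℕ → (Vertex n → Subset m) → Set
IsMinDiffRep {n} B k A =
  (u v : Vertex n) → u ≢ v →
  (adj B u v ≡ true) ⇔ (k ≤ (∣ A u ─ A v ∣ ⊓ ∣ A v ─ A u ∣))

HasMinDiffRep : ∀ {n} → BipGraph n → ℕ → Set
HasMinDiffRep {n} B k = Σ ℕ λ m → Σ (Vertex n → Subset m) λ A → IsMinDiffRep B k A

-- f_min(B) ≥ (p/q) · n / ⌊log₂ n⌋ :  every positive k admitting a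
-- k-min-difference representation satisfies k ≥ p·n / (q·⌊log₂ n⌋).
FminLowerBound : ∀ {n} → ℕ → ℕ → BipGraph n → Set
FminLowerBound {n} p q B =
  (k : ℕ) → 1 ≤ k → HasMinDiffRep B k → p * n ≤ k * (q * ⌊log₂ n ⌋)

{-# OPTIONS --safe #-}
-- Suppose G is represented by sets A i (i ∈ V₁) and B j (j ∈ V₂) with parameter k.  Vertices on the
-- same side are not adjacent, so, once a side is sorted by size, fewer than k elements are lost from
-- each set to the next: both sides are almost chains.  Hence at most n k elements x ever leave the
-- A-chain, and these x enter and leave the two chains O(n k) times altogether; recording these events
-- takes O(n k log n) bits.  On the remaining elements |A i ∖ B j| is monotone in the rank of i, so for
-- each j it is determined up to the level k by k + 1 thresholds.  Therefore G, which is determined by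
-- the tests k ≤ |A i ∖ B j| and k ≤ |B j ∖ A i|, is encoded by O(n k log n) bits, and few graphs admit
-- a representation with k below c n / log n.
module Submission where

open import Defs
import Algebra.Properties.CommutativeMonoid.Sum
open import Data.Bool using (Bool; true; false; _∧_; not; if_then_else_)
open import Data.Bool.Properties using (T-≡) renaming (_≟_ to _≟ᵇ_)
open import Data.Fin using (Fin; zero; suc; toℕ; fromℕ<)
open import Data.Fin.Properties as Fin using (toℕ-fromℕ<)
open import Data.Fin.Subset using (Subset; _─_; ∣_∣; inside; outside)
open import Data.List as List using (List; []; _∷_; _++_; length; map; concat; concatMap; foldl;
  filter; upTo; allFin; cartesianProduct; cartesianProductWith)
open import Data.List.Membership.Propositional using (_∈_; _∉_; lose)
open import Data.List.Membership.Propositional.Properties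
import Data.List.Membership.DecPropositional as DecMembership
open import Data.List.Properties using (++-assoc; length-++; length-map; length-filter; length-tabulate; length-upTo)
open import Data.List.Relation.Binary.Permutation.Propositional using (↭-sym)
open import Data.List.Relation.Binary.Permutation.Propositional.Properties using (∈-resp-↭; ↭-length)
open import Data.List.Relation.Binary.Subset.Propositional using (_⊆_)
open import Data.List.Relation.Unary.All as All using (All; []; _∷_)
import Data.List.Relation.Unary.All.Properties as All
open import Data.List.Relation.Unary.AllPairs using ([]; _∷_)
open import Data.List.Relation.Unary.Any using (here; there)
open import Data.List.Relation.Unary.Linked using (Linked; []; [-]; _∷_)
open import Data.List.Relation.Unary.Unique.Propositional using (Unique)
import Data.List.Relation.Unary.Unique.Propositional.Properties as Unique
import Data.List.Sort
open import Data.Nat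
open import Data.Nat.DivMod using (_mod_; m<n⇒m%n≡m)
open import Data.Nat.Logarithm using (⌊log₂_⌋; ⌊log₂⌋-mono-≤; ⌊log₂[2^n]⌋≡n)
open import Data.Nat.Properties
open import Data.Nat.Tactic.RingSolver using (solve-∀)
open import Data.Product using (Σ; ∃; _×_; _,_; proj₁; proj₂)
open import Data.Sum using (inj₁; inj₂)
open import Data.Sum.Properties using (inj₁-injective; inj₂-injective)
open import Data.Vec as Vec using (Vec; []; _∷_)
open import Data.Vec.Properties using (∷-injective; lookup∘tabulate; tabulate∘lookup; tabulate-cong; ≡-dec)
open import Function using (_∘_; id; _⇔_; mk⇔; Equivalence)
open import Relation.Binary.PropositionalEquality
open import Relation.Nullary using (Dec; yes; no; does; ¬?; _×-dec_; contradiction)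
open import Relation.Nullary.Decidable using (does-⇔)
open import Relation.Unary using (Decidable)
import Relation.Binary.Construct.On as On

open Algebra.Properties.CommutativeMonoid.Sum +-0-commutativeMonoid
  using (sum; sum-cong-≗; ∑-distrib-+)

-- Finite sums, and set differences as sums of indicators.

sum-mono-≤ : ∀ {m} {f g : Fin m → ℕ} → (∀ x → f x ≤ g x) → sum f ≤ sum g
sum-mono-≤ {zero}  f≤g = z≤n
sum-mono-≤ {suc m} f≤g = +-mono-≤ (f≤g zero) (sum-mono-≤ (f≤g ∘ suc))

sum-zero : ∀ {m} {f : Fin m → ℕ} → (∀ x → f x ≡ 0) → sum f ≡ 0
sum-zero {zero}  f≡0 = refl
sum-zero {suc m} f≡0 = cong₂ _+_ (f≡0 zero) (sum-zero (f≡0 ∘ suc))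

*-distribˡ-sum : ∀ {m} c (f : Fin m → ℕ) → sum (λ x → c * f x) ≡ c * sum f
*-distribˡ-sum {zero}  c f = sym (*-zeroʳ c)
*-distribˡ-sum {suc m} c f =
  trans (cong (c * f zero +_) (*-distribˡ-sum c (f ∘ suc))) (sym (*-distribˡ-+ c _ _))

bit : Bool → ℕ
bit true  = 1
bit false = 0

infix 6 _∖_

_∖_ : Bool → Bool → Bool
a ∖ b = a ∧ not b

excess : ∀ {m} → (Fin m → Bool) → (Fin m → Bool) → ℕ
excess p q = sum λ x → bit (p x ∖ q x)

size : ∀ {m} → (Fin m → Bool) → ℕ
size p = sum (bit ∘ p)

∣─∣≡excess : ∀ {m} (p q : Subset m) → ∣ p ─ q ∣ ≡ excess (Vec.lookup p) (Vec.lookup q)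
∣─∣≡excess []            []            = refl
∣─∣≡excess (inside  ∷ p) (inside  ∷ q) = ∣─∣≡excess p q
∣─∣≡excess (inside  ∷ p) (outside ∷ q) = cong suc (∣─∣≡excess p q)
∣─∣≡excess (outside ∷ p) (inside  ∷ q) = ∣─∣≡excess p q
∣─∣≡excess (outside ∷ p) (outside ∷ q) = ∣─∣≡excess p q

-- Both sides are the size of the union.
excess+size : ∀ {m} (p q : Fin m → Bool) → excess p q + size q ≡ excess q p + size p
excess+size p q = trans (sym (∑-distrib-+ (λ x → bit (p x ∖ q x)) (bit ∘ q)))
  (trans (sum-cong-≗ λ x → pointwise (p x) (q x)) (∑-distrib-+ (λ x → bit (q x ∖ p x)) (bit ∘ p)))
  where
  pointwise : ∀ a b → bit (a ∖ b) + bit b ≡ bit (b ∖ a) + bit a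
  pointwise true  true  = refl
  pointwise true  false = refl
  pointwise false true  = refl
  pointwise false false = refl

excess-self : ∀ {m} (p : Fin m → Bool) → excess p p ≡ 0
excess-self p = sum-zero λ x → pointwise (p x)
  where
  pointwise : ∀ a → bit (a ∖ a) ≡ 0
  pointwise true  = refl
  pointwise false = refl

-- Almost chains

IsAlmostChain : ∀ {m} → ℕ → (ℕ → Fin m → Bool) → Set
IsAlmostChain k α = ∀ t → excess (α t) (α (suc t)) ≤ k

-- Position 0 holds the empty set, so that ranks start at 1; beyond the last rank the sequence is
-- constantly the full set, so that no descent occurs there.
record Chain {n m} (k : ℕ) (A : Fin n → Fin m → Bool) : Set where
  field
    seq          : ℕ → Fin m → Bool
    seq-zero     : ∀ x → seq 0 x ≡ false
    almost-chain : IsAlmostChain k seq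
    rank         : Fin n → ℕ
    rank≤n       : ∀ i → rank i ≤ n
    seq-rank     : ∀ i x → seq (rank i) x ≡ A i x

module _ {n m} {k : ℕ} (A : Fin n → Fin m → Bool)
  (close : ∀ i j → i ≢ j → excess (A i) (A j) ⊓ excess (A j) (A i) ≤ k) where

  private
    bySize = On.decTotalOrder ≤-decTotalOrder (size ∘ A)

    open Data.List.Sort bySize using (sort; sort-↭; sort-↗)

  -- By `excess+size` the smaller set also has the smaller difference, so this difference is the
  -- minimum bounded by `close`. Equal indices, which `close` does not cover, give 0.
  size≤⇒excess≤k : ∀ i j → size (A i) ≤ size (A j) → excess (A i) (A j) ≤ k
  size≤⇒excess≤k i j le with i Fin.≟ j
  ... | yes refl = ≤-trans (≤-reflexive (excess-self (A i))) z≤n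
  ... | no i≢j   = ≤-trans (≤-reflexive (sym (m≤n⇒m⊓n≡m ij≤ji))) (close i j i≢j)
    where
    ij≤ji : excess (A i) (A j) ≤ excess (A j) (A i)
    ij≤ji = +-cancelʳ-≤ (size (A i)) _ _ (≤-trans (+-monoʳ-≤ (excess (A i) (A j)) le)
      (≤-reflexive (excess+size (A i) (A j))))

  listSeq : List (Fin n) → ℕ → Fin m → Bool
  listSeq []       _       _ = true
  listSeq (i ∷ is) zero    x = A i x
  listSeq (i ∷ is) (suc t) x = listSeq is t x

  listSeq-almost-chain : ∀ {is} → Linked (λ i j → size (A i) ≤ size (A j)) is →
    IsAlmostChain k (listSeq is)
  listSeq-almost-chain []  t = ≤-trans (≤-reflexive (excess-self {m} λ _ → true)) z≤n
  listSeq-almost-chain ([-] {x = i}) zero =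
    ≤-trans (≤-reflexive (sum-zero λ x → below-true (A i x))) z≤n
    where
    below-true : ∀ a → bit (a ∖ true) ≡ 0
    below-true true  = refl
    below-true false = refl
  listSeq-almost-chain [-] (suc t) = listSeq-almost-chain [] t
  listSeq-almost-chain (le ∷ l) zero    = size≤⇒excess≤k _ _ le
  listSeq-almost-chain (le ∷ l) (suc t) = listSeq-almost-chain l t

  listSeq-index : ∀ {i is} → i ∈ is → ∃ λ t → t < length is × (∀ x → listSeq is t x ≡ A i x)
  listSeq-index (here refl) = 0 , z<s , λ _ → refl
  listSeq-index (there i∈)  = let t , t< , eq = listSeq-index i∈ in suc t , s<s t< , eq

  chain : Chain k A
  chain = record
    { seq          = seq
    ; seq-zero     = λ _ → refl
    ; almost-chain = almost
    ; rank         = λ i → suc (proj₁ (position i))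
    ; rank≤n       = λ i → subst (suc (proj₁ (position i)) ≤_) length-sorted (proj₁ (proj₂ (position i)))
    ; seq-rank     = λ i → proj₂ (proj₂ (position i))
    }
    where
    sorted = sort (allFin n)

    length-sorted : length sorted ≡ n
    length-sorted = trans (↭-length (sort-↭ _)) (length-tabulate {n = n} id)

    seq : ℕ → Fin m → Bool
    seq zero    _ = false
    seq (suc t) x = listSeq sorted t x

    almost : IsAlmostChain k seq
    almost zero    = ≤-trans (≤-reflexive (sum-zero {m} λ _ → refl)) z≤n
    almost (suc t) = listSeq-almost-chain (sort-↗ _) t

    position : ∀ i → _
    position i = listSeq-index (∈-resp-↭ (↭-sym (sort-↭ _)) (∈-allFin i))

-- Descents along a chain, and thresholds of monotone predicates.

descents : (ℕ → Bool) → ℕ → ℕ → ℕ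
descents f t zero    = 0
descents f t (suc r) = bit (f t ∖ f (suc t)) + descents f (suc t) r

-- Double counting: the elements that leave at a given step number exactly the excess of two
-- consecutive sets, hence at most `k`.
sum-descents : ∀ {m k} (α : ℕ → Fin m → Bool) → IsAlmostChain k α →
  ∀ t r → sum (λ x → descents (λ s → α s x) t r) ≤ r * k
sum-descents {m} α ac t zero    = ≤-reflexive (sum-zero {m} λ _ → refl)
sum-descents α ac t (suc r) = ≤-trans
  (≤-reflexive (∑-distrib-+ (λ x → bit (α t x ∖ α (suc t) x)) (λ x → descents (λ s → α s x) (suc t) r)))
  (+-mono-≤ (ac t) (sum-descents α ac (suc t) r))

no-descent⇒step : ∀ f t r → descents f t r ≡ 0 →
  ∀ i → t ≤ i → i < t + r → f i ≡ true → f (suc i) ≡ true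
no-descent⇒step f t zero d i t≤i i<t fi =
  contradiction (≤-trans i<t (≤-reflexive (+-identityʳ t))) (≤⇒≯ t≤i)
no-descent⇒step f t (suc r) d i t≤i i< fi with t ≟ i
... | no t≢i = no-descent⇒step f (suc t) r (m+n≡0⇒n≡0 _ d) i (≤∧≢⇒< t≤i t≢i)
                 (≤-trans i< (≤-reflexive (+-suc t r))) fi
... | yes refl with f t | f (suc t) | m+n≡0⇒m≡0 (bit (f t ∖ f (suc t))) d
...   | true | true  | _ = refl

-- The value `s = suc n` stands for a predicate that fails on all of 0, ..., n; labels therefore
-- have to reach `suc n`.
threshold : ∀ {P : ℕ → Set} → (∀ i → Dec (P i)) → ∀ n → (∀ i → i < n → P i → P (suc i)) →
  ∃ λ s → s ≤ suc n × (∀ i → i ≤ n → P i ⇔ s ≤ i)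
threshold {P} P? n step with P? 0
... | yes p0 = 0 , z≤n , λ i i≤n → mk⇔ (λ _ → z≤n) (λ _ → always i i≤n)
  where
  always : ∀ i → i ≤ n → P i
  always zero    _   = p0
  always (suc i) i<n = step i i<n (always i (<⇒≤ i<n))
threshold P? zero step | no ¬p0 =
  1 , ≤-refl , λ { zero z≤n → mk⇔ (λ p0 → contradiction p0 ¬p0) (λ ()) }
threshold P? (suc n) step | no ¬p0
  with s , s≤ , spec ← threshold (P? ∘ suc) n (λ i i<n → step (suc i) (s<s i<n)) =
  suc s , s≤s s≤ , λ where
    zero    _   → mk⇔ (λ p0 → contradiction p0 ¬p0) (λ ())
    (suc i) i≤n → let open Equivalence (spec i (s≤s⁻¹ i≤n)) in mk⇔ (s≤s ∘ to) (from ∘ s≤s⁻¹)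

-- Encoding of the elements that leave the chain

data Symbol (P : ℕ) : Set where
  end        : Symbol P
  left right : Fin P → Symbol P

-- A change at position `t` is visible from index `i` only if `t ≤ i`. Folding over all changes thus
-- recovers membership at any `i`, and one word serves all pairs of ranks.
flip : ∀ {P} → ℕ → Bool → Fin P → Bool
flip i a t = if toℕ t ≤ᵇ i then not a else a

-- A word describes a list of elements: the description of an element x lists the positions at which
-- x enters or leaves the first, respectively second, chain, and ends with end.  The result counts
-- the elements that lie in the i-th set of the first chain but not in the j-th set of the second.
tally : ∀ {P} → ℕ → ℕ → Bool → Bool → List (Symbol P) → ℕ
tally i j a b []            = 0
tally i j a b (end     ∷ w) = bit (a ∖ b) + tally i j false false w
tally i j a b (left t  ∷ w) = tally i j (flip i a t) b w
tally i j a b (right t ∷ w) = tally i j a (flip j b t) w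

tally-left : ∀ {P} i j a b (ts : List (Fin P)) w →
  tally i j a b (map left ts ++ w) ≡ tally i j (foldl (flip i) a ts) b w
tally-left i j a b []       w = refl
tally-left i j a b (t ∷ ts) w = tally-left i j (flip i a t) b ts w

tally-right : ∀ {P} i j a b (ts : List (Fin P)) w →
  tally i j a b (map right ts ++ w) ≡ tally i j a (foldl (flip j) b ts) w
tally-right i j a b []       w = refl
tally-right i j a b (t ∷ ts) w = tally-right i j a (flip j b t) ts w

-- The hypothesis says that each block `f x` counts `c x` and then acts as if the state were
-- `false false` again, so the blocks do not interact.
tally-concat : ∀ {P m} i j (f : Fin m → List (Symbol P)) (c : Fin m → ℕ) →
  (∀ x w → tally i j false false (f x ++ w) ≡ c x + tally i j false false w) →
  tally i j false false (concat (List.tabulate f)) ≡ sum c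
tally-concat {m = zero}  i j f c eq = refl
tally-concat {m = suc m} i j f c eq = trans (eq zero _)
  (cong (c zero +_) (tally-concat i j (f ∘ suc) (c ∘ suc) (eq ∘ suc)))

length-concat-tabulate : ∀ {m} {A : Set} (f : Fin m → List A) →
  length (concat (List.tabulate f)) ≡ sum (length ∘ f)
length-concat-tabulate {zero}  f = refl
length-concat-tabulate {suc m} f = trans (length-++ (f zero))
  (cong (length (f zero) +_) (length-concat-tabulate (f ∘ suc)))

-- Padding with end would be wrong in a state a b with bit (a ∖ b) = 1.
pad : ∀ {P} → Fin P → ∀ T → List (Symbol P) → Vec (Symbol P) T
pad t zero    w       = []
pad t (suc T) []      = left t ∷ pad t T []
pad t (suc T) (s ∷ w) = s ∷ pad t T w

-- Only `end` adds to the count, so the symbols `left t` appended at the tail change the state but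
-- not the result.
tally-pad : ∀ {P} (t : Fin P) {T} i j a b w → length w ≤ T →
  tally i j a b (Vec.toList (pad t T w)) ≡ tally i j a b w
tally-pad t {zero}  i j a b []            _        = refl
tally-pad t {suc T} i j a b []            _        = tally-pad t {T} i j (flip i a t) b [] z≤n
tally-pad t {suc T} i j a b (end     ∷ w) (s≤s le) =
  cong (bit (a ∖ b) +_) (tally-pad t i j false false w le)
tally-pad t {suc T} i j a b (left u  ∷ w) (s≤s le) = tally-pad t i j (flip i a u) b w le
tally-pad t {suc T} i j a b (right u ∷ w) (s≤s le) = tally-pad t i j a (flip j b u) w le

flip-≤ : ∀ {P} {t : Fin P} {i} a → toℕ t ≤ i → flip i a t ≡ not a
flip-≤ {t = t} {i} a t≤i with toℕ t ≤ᵇ i | ≤⇒≤ᵇ t≤i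
... | true | _ = refl

flip-> : ∀ {P} {t : Fin P} {i} a → i < toℕ t → flip i a t ≡ a
flip-> {t = t} {i} a i<t with toℕ t ≤ᵇ i in eq
... | true  = contradiction (≤ᵇ⇒≤ (toℕ t) i (Equivalence.from T-≡ eq)) (<⇒≱ i<t)
... | false = refl

-- Codes for the comparison of two chains, and their decoding.

when unless : ℕ → ℕ → ℕ
when   zero    c = 0
when   (suc _) c = c
unless zero    c = c
unless (suc _) c = 0

when+unless : ∀ d c → when d c + unless d c ≡ c
when+unless zero    c = refl
when+unless (suc _) c = +-identityʳ c

-- The ranks in the two chains, the thresholds by level and by j, and the word of the described elements.
Code : ℕ → ℕ → ℕ → Set
Code n k P = Vec (Fin P) n × Vec (Fin P) n × Vec (Vec (Fin P) n) (suc k) × Vec (Symbol P) (7 * (n * k))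

-- If the described elements contribute `e` to the excess, the others must contribute `k ∸ e`. This
-- takes only `suc k` values, so `suc k` rows of thresholds suffice.
level : ∀ k → ℕ → Fin (suc k)
level k e = fromℕ< (s≤s (m∸n≤m k e))

toℕ-level : ∀ k e → toℕ (level k e) ≡ k ∸ e
toℕ-level k e = toℕ-fromℕ< (s≤s (m∸n≤m k e))

-- The word gives the contribution `e` of the described elements; this selects the row, whose entry
-- at `j` is the least rank at which the remaining elements make up for the rest.
decode : ∀ {n k P} → Code n k P → Fin n → Fin n → Bool
decode {k = k} (ρ , σ , θ , w) i j = does (toℕ (Vec.lookup (Vec.lookup θ (level k e)) j) ≤? rᵢ)
  where
  rᵢ = toℕ (Vec.lookup ρ i)
  e  = tally rᵢ (toℕ (Vec.lookup σ j)) false false (Vec.toList w)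

-- Construction of the code and its correctness.

module _ {n P : ℕ} (label : ℕ → Fin P) (toℕ-label : ∀ t → t ≤ suc n → toℕ (label t) ≡ t) where

  -- A change between `t` and `suc t` is labelled `suc t`, the first index at which it shows.
  toggles : (ℕ → Bool) → ℕ → ℕ → List (Fin P)
  toggles f t zero    = []
  toggles f t (suc r) with f t | f (suc t)
  ... | true  | false = label (suc t) ∷ toggles f (suc t) r
  ... | false | true  = label (suc t) ∷ toggles f (suc t) r
  ... | true  | true  = toggles f (suc t) r
  ... | false | false = toggles f (suc t) r

  -- Entries and departures alternate, so they differ in number by at most one. A sequence that
  -- starts at `true` begins with a departure, which saves one toggle; the summand `bit (f t)`
  -- carries this through the induction.
  length-toggles : ∀ f t r → length (toggles f t r) + bit (f t) ≤ 2 * descents f t r + 1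
  length-toggles f t zero with f t
  ... | true  = ≤-refl
  ... | false = z≤n
  length-toggles f t (suc r) with f t | f (suc t) | length-toggles f (suc t) r
  ... | true  | true  | ih = ih
  ... | false | false | ih = ih
  ... | false | true  | ih = ≤-trans (≤-reflexive (trans (+-identityʳ _) (+-comm 1 _))) ih
  ... | true  | false | ih = ≤-trans (≤-reflexive (regroup (length (toggles f (suc t) r))))
    (≤-trans (+-monoʳ-≤ 2 ih) (≤-reflexive (regroup′ (descents f (suc t) r))))
    where
    regroup : ∀ l → suc (l + 1) ≡ 2 + (l + 0)
    regroup = solve-∀
    regroup′ : ∀ d → 2 + (2 * d + 1) ≡ 2 * suc d + 1
    regroup′ = solve-∀

  flip-label-> : ∀ {i t} a → i ≤ t → t < n → flip i a (label (suc t)) ≡ a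
  flip-label-> a i≤t t<n = flip-> a (≤-trans (s≤s i≤t) (≤-reflexive (sym (toℕ-label _ (m≤n⇒m≤1+n t<n)))))

  flip-label-≤ : ∀ {i t} a → t < i → t < n → flip i a (label (suc t)) ≡ not a
  flip-label-≤ a t<i t<n = flip-≤ a (≤-trans (≤-reflexive (toℕ-label _ (m≤n⇒m≤1+n t<n))) t<i)

  private
    shift : ∀ {t r} → t + suc r ≤ n → suc t + r ≤ n
    shift {t} {r} = ≤-trans (≤-reflexive (sym (+-suc t r)))

    head< : ∀ {t r} → t + suc r ≤ n → t < n
    head< {t} {r} le = ≤-trans (m≤m+n (suc t) r) (shift le)

  -- All labels produced from `t ≥ i` on exceed `i`, so none of these toggles acts.
  foldl-toggles-> : ∀ f {i} a t r → i ≤ t → t + r ≤ n → foldl (flip i) a (toggles f t r) ≡ a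
  foldl-toggles-> f a t zero    i≤t le = refl
  foldl-toggles-> f {i} a t (suc r) i≤t le
    with f t | f (suc t) | foldl-toggles-> f a (suc t) r (m≤n⇒m≤1+n i≤t) (shift le)
  ... | true  | true  | ih = ih
  ... | false | false | ih = ih
  ... | true  | false | ih =
    trans (cong (λ a → foldl (flip i) a (toggles f (suc t) r)) (flip-label-> a i≤t (head< le))) ih
  ... | false | true  | ih =
    trans (cong (λ a → foldl (flip i) a (toggles f (suc t) r)) (flip-label-> a i≤t (head< le))) ih

  foldl-toggles : ∀ f {i} t r → t ≤ i → i ≤ t + r → t + r ≤ n →
    foldl (flip i) (f t) (toggles f t r) ≡ f i
  foldl-toggles f {i} t r t≤i i≤ le with t ≟ i
  ... | yes refl = foldl-toggles-> f (f t) t r ≤-refl le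
  foldl-toggles f {i} t zero t≤i i≤ le | no t≢i =
    contradiction (≤-antisym t≤i (≤-trans i≤ (≤-reflexive (+-identityʳ t)))) t≢i
  foldl-toggles f {i} t (suc r) t≤i i≤ le | no t≢i
    with f t | f (suc t)
       | foldl-toggles f {i} (suc t) r (≤∧≢⇒< t≤i t≢i) (≤-trans i≤ (≤-reflexive (+-suc t r))) (shift le)
  ... | true  | true  | ih = ih
  ... | false | false | ih = ih
  ... | true  | false | ih = trans (cong (λ a → foldl (flip i) a (toggles f (suc t) r))
                                     (flip-label-≤ true (≤∧≢⇒< t≤i t≢i) (head< le))) ih
  ... | false | true  | ih = trans (cong (λ a → foldl (flip i) a (toggles f (suc t) r))
                                     (flip-label-≤ false (≤∧≢⇒< t≤i t≢i) (head< le))) ih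

  element : (f g : ℕ → Bool) → List (Symbol P)
  element f g = map left (toggles f 0 n) ++ map right (toggles g 0 n) ++ end ∷ []

  tally-element : ∀ f g {i j} → f 0 ≡ false → g 0 ≡ false → i ≤ n → j ≤ n → ∀ w →
    tally i j false false (element f g ++ w) ≡ bit (f i ∖ g j) + tally i j false false w
  tally-element f g {i} {j} f0 g0 i≤n j≤n w = begin
    tally i j false false ((map left ts ++ map right us ++ end ∷ []) ++ w)
      ≡⟨ cong (tally i j false false) (++-assoc (map left ts) _ w) ⟩
    tally i j false false (map left ts ++ (map right us ++ end ∷ []) ++ w)
      ≡⟨ cong (λ v → tally i j false false (map left ts ++ v)) (++-assoc (map right us) _ w) ⟩
    tally i j false false (map left ts ++ map right us ++ end ∷ w)
      ≡⟨ tally-left i j false false ts _ ⟩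
    tally i j (foldl (flip i) false ts) false (map right us ++ end ∷ w)
      ≡⟨ tally-right i j _ false us _ ⟩
    bit (foldl (flip i) false ts ∖ foldl (flip j) false us) + tally i j false false w
      ≡⟨ cong₂ (λ a b → bit (a ∖ b) + tally i j false false w) (final f f0 i≤n) (final g g0 j≤n) ⟩
    bit (f i ∖ g j) + tally i j false false w ∎
    where
    open ≡-Reasoning
    ts = toggles f 0 n
    us = toggles g 0 n
    final : ∀ f {i} → f 0 ≡ false → i ≤ n → foldl (flip i) false (toggles f 0 n) ≡ f i
    final f {i} f0 i≤n =
      trans (cong (λ a → foldl (flip i) a (toggles f 0 n)) (sym f0)) (foldl-toggles f 0 n z≤n i≤n ≤-refl)

  length-element : ∀ f g → length (element f g) ≤ 2 * descents f 0 n + 2 * descents g 0 n + 3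
  length-element f g = begin
    length (element f g)
      ≡⟨ length-++ (map left (toggles f 0 n)) ⟩
    length (map left (toggles f 0 n)) + length (map right (toggles g 0 n) ++ end ∷ [])
      ≡⟨ cong₂ _+_ (length-map left (toggles f 0 n)) (trans (length-++ (map right (toggles g 0 n)))
           (cong (_+ 1) (length-map right (toggles g 0 n)))) ⟩
    length (toggles f 0 n) + (length (toggles g 0 n) + 1)
      ≤⟨ +-mono-≤ (m+n≤o⇒m≤o (length (toggles f 0 n)) (length-toggles f 0 n))
           (+-monoˡ-≤ 1 (m+n≤o⇒m≤o (length (toggles g 0 n)) (length-toggles g 0 n))) ⟩
    (2 * descents f 0 n + 1) + (2 * descents g 0 n + 1 + 1)
      ≡⟨ regroup (2 * descents f 0 n) (2 * descents g 0 n) ⟩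
    2 * descents f 0 n + 2 * descents g 0 n + 3 ∎
    where
    open ≤-Reasoning
    regroup : ∀ a b → (a + 1) + (b + 1 + 1) ≡ a + b + 3
    regroup = solve-∀

  module _ {k m} {A B : Fin n → Fin m → Bool} (CA : Chain k A) (CB : Chain k B) where

    private
      module CA = Chain CA
      module CB = Chain CB

      α β : Fin m → ℕ → Bool
      α x t = CA.seq t x
      β x t = CB.seq t x

      dα dβ : Fin m → ℕ
      dα x = descents (α x) 0 n
      dβ x = descents (β x) 0 n

      -- The ground set may be arbitrarily large, so elements without a descent in the first chain
      -- must cost nothing: their description is empty, without even an `end`.
      describe : ℕ → List (Symbol P) → List (Symbol P)
      describe zero    v = []
      describe (suc _) v = v

      description : Fin m → List (Symbol P)
      description x = describe (dα x) (element (α x) (β x))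

      word : List (Symbol P)
      word = concat (List.tabulate description)

      length-description : ∀ x → length (description x) ≤ 5 * dα x + 2 * dβ x
      length-description x with dα x | length-element (α x) (β x)
      ... | zero  | _  = z≤n
      -- A described element has `dα x = suc d ≥ 1`, so the constant 3 of `length-element` is
      -- absorbed into `3 * dα x`; this turns 2 into 5.
      ... | suc d | le = ≤-trans le (≤-trans (m≤m+n _ (3 * d)) (≤-reflexive (regroup d (dβ x))))
        where
        regroup : ∀ d e → 2 * suc d + 2 * e + 3 + 3 * d ≡ 5 * suc d + 2 * e
        regroup = solve-∀

      length-word : length word ≤ 7 * (n * k)
      length-word = begin
        length word                                  ≡⟨ length-concat-tabulate description ⟩
        sum (length ∘ description)                   ≤⟨ sum-mono-≤ length-description ⟩
        sum (λ x → 5 * dα x + 2 * dβ x)              ≡⟨ ∑-distrib-+ (λ x → 5 * dα x) (λ x → 2 * dβ x) ⟩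
        sum (λ x → 5 * dα x) + sum (λ x → 2 * dβ x)  ≡⟨ cong₂ _+_ (*-distribˡ-sum 5 dα) (*-distribˡ-sum 2 dβ) ⟩
        5 * sum dα + 2 * sum dβ                      ≤⟨ +-mono-≤ (*-monoʳ-≤ 5 (sum-descents CA.seq CA.almost-chain 0 n))
                                                                 (*-monoʳ-≤ 2 (sum-descents CB.seq CB.almost-chain 0 n)) ⟩
        5 * (n * k) + 2 * (n * k)                    ≡⟨ sym (*-distribʳ-+ (n * k) 5 2) ⟩
        7 * (n * k)                                  ∎
        where open ≤-Reasoning

      describedExcess steadyExcess : ℕ → ℕ → ℕ
      describedExcess i j = sum λ x → when   (dα x) (bit (α x i ∖ β x j))
      steadyExcess    i j = sum λ x → unless (dα x) (bit (α x i ∖ β x j))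

      described+steady : ∀ i j → describedExcess i j + steadyExcess i j ≡ excess (CA.seq i) (CB.seq j)
      described+steady i j = trans
        (sym (∑-distrib-+ (λ x → when (dα x) (bit (α x i ∖ β x j))) (λ x → unless (dα x) (bit (α x i ∖ β x j)))))
        (sum-cong-≗ λ x → when+unless (dα x) _)

      tally-word : ∀ {i j} → i ≤ n → j ≤ n → tally i j false false word ≡ describedExcess i j
      tally-word {i} {j} i≤n j≤n = tally-concat i j description _ pointwise
        where
        pointwise : ∀ x w → tally i j false false (description x ++ w)
          ≡ when (dα x) (bit (α x i ∖ β x j)) + tally i j false false w
        pointwise x w with dα x
        ... | zero  = refl
        ... | suc _ = tally-element (α x) (β x) (CA.seq-zero x) (CB.seq-zero x) i≤n j≤n w

      -- An element without descents stays in the first chain once it has entered, while the set of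
      -- the second chain is fixed. Its behaviour in the second chain is unrestricted.
      steadyExcess-step : ∀ i j → i < n → steadyExcess i j ≤ steadyExcess (suc i) j
      steadyExcess-step i j i<n = sum-mono-≤ pointwise
        where
        pointwise : ∀ x → unless (dα x) (bit (α x i ∖ β x j)) ≤ unless (dα x) (bit (α x (suc i) ∖ β x j))
        pointwise x with dα x in d
        ... | suc _ = z≤n
        ... | zero with α x i in αi
        ...   | false = z≤n
        ...   | true  rewrite no-descent⇒step (α x) 0 n d i z≤n i<n αi = ≤-refl

      thresholds : ∀ l j → _
      thresholds l j = threshold {λ i → l ≤ steadyExcess i j} (λ i → l ≤? steadyExcess i j) n
        (λ i i<n le → ≤-trans le (steadyExcess-step i j i<n))

      thresholdRow : ℕ → Vec (Fin P) n
      thresholdRow l = Vec.tabulate (label ∘ λ j → proj₁ (thresholds l (CB.rank j)))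

      code : Code n k P
      code = Vec.tabulate (label ∘ CA.rank)
           , Vec.tabulate (label ∘ CB.rank)
           , Vec.tabulate (thresholdRow ∘ toℕ)
           , pad (label 0) _ word

    -- The excess is `e` plus the steady excess, so it reaches `k` iff the latter reaches `k ∸ e`,
    -- which by monotonicity in the rank is a comparison with a threshold.
    encode : Σ (Code n k P) λ c → ∀ i j → decode c i j ≡ does (k ≤? excess (A i) (B j))
    encode = code , correct
      where
      toℕ-lookup : ∀ {l} (r : Fin l → ℕ) (x : Fin l) → r x ≤ suc n →
        toℕ (Vec.lookup (Vec.tabulate (label ∘ r)) x) ≡ r x
      toℕ-lookup r x r≤ = trans (cong toℕ (lookup∘tabulate (label ∘ r) x)) (toℕ-label _ r≤)

      correct : ∀ i j → decode code i j ≡ does (k ≤? excess (A i) (B j))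
      correct i j = trans (cong₂ (λ r e → does (toℕ (Vec.lookup (Vec.lookup θ (level k e)) j) ≤? r)) rᵢ≡ e≡)
        (trans (cong (λ s → does (s ≤? CA.rank i)) s≡)
          (does-⇔ (mk⇔ to′ from′) (s ≤? CA.rank i) (k ≤? excess (A i) (B j))))
        where
        θ = proj₁ (proj₂ (proj₂ code))
        e = describedExcess (CA.rank i) (CB.rank j)
        s = proj₁ (thresholds (k ∸ e) (CB.rank j))

        rᵢ≡ : toℕ (Vec.lookup (proj₁ code) i) ≡ CA.rank i
        rᵢ≡ = toℕ-lookup CA.rank i (m≤n⇒m≤1+n (CA.rank≤n i))

        e≡ : tally (toℕ (Vec.lookup (proj₁ code) i)) (toℕ (Vec.lookup (proj₁ (proj₂ code)) j))
               false false (Vec.toList (pad (label 0) (7 * (n * k)) word)) ≡ e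
        e≡ = trans (cong₂ (λ r r′ → tally r r′ false false (Vec.toList (pad (label 0) (7 * (n * k)) word)))
                      rᵢ≡ (toℕ-lookup CB.rank j (m≤n⇒m≤1+n (CB.rank≤n j))))
             (trans (tally-pad (label 0) (CA.rank i) (CB.rank j) false false word length-word)
                    (tally-word (CA.rank≤n i) (CB.rank≤n j)))

        s≡ : toℕ (Vec.lookup (Vec.lookup θ (level k e)) j) ≡ s
        s≡ = trans (cong (λ v → toℕ (Vec.lookup v j)) (lookup∘tabulate (thresholdRow ∘ toℕ) (level k e)))
             (trans (cong (λ l → toℕ (Vec.lookup (thresholdRow l) j)) (toℕ-level k e))
                    (toℕ-lookup (λ j → proj₁ (thresholds (k ∸ e) (CB.rank j))) j
                       (proj₁ (proj₂ (thresholds (k ∸ e) (CB.rank j))))))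

        total : e + steadyExcess (CA.rank i) (CB.rank j) ≡ excess (A i) (B j)
        total = trans (described+steady _ _)
          (sum-cong-≗ λ x → cong₂ (λ a b → bit (a ∖ b)) (CA.seq-rank i x) (CB.seq-rank j x))

        open Equivalence (proj₂ (proj₂ (thresholds (k ∸ e) (CB.rank j))) (CA.rank i) (CA.rank≤n i))

        to′ : s ≤ CA.rank i → k ≤ excess (A i) (B j)
        to′ s≤ = ≤-trans (m≤n+m∸n k e) (≤-trans (+-monoʳ-≤ e (from s≤)) (≤-reflexive total))

        from′ : k ≤ excess (A i) (B j) → s ≤ CA.rank i
        from′ k≤ = to (m≤n+o⇒m∸n≤o k e (≤-trans k≤ (≤-reflexive (sym total))))

-- Enumeration of vectors and codes.

length-cartesianProductWith : ∀ {A B C : Set} (f : A → B → C) xs ys →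
  length (cartesianProductWith f xs ys) ≡ length xs * length ys
length-cartesianProductWith f []       ys = refl
length-cartesianProductWith f (x ∷ xs) ys = trans (length-++ (map (f x) ys))
  (cong₂ _+_ (length-map (f x) ys) (length-cartesianProductWith f xs ys))

module _ {A : Set} where

  vectors : List A → ∀ n → List (Vec A n)
  vectors xs zero    = [] ∷ []
  vectors xs (suc n) = cartesianProductWith _∷_ xs (vectors xs n)

  length-vectors : ∀ xs n → length (vectors xs n) ≡ length xs ^ n
  length-vectors xs zero    = refl
  length-vectors xs (suc n) = trans (length-cartesianProductWith _∷_ xs (vectors xs n))
    (cong (length xs *_) (length-vectors xs n))

  ∈-vectors : ∀ {xs} → (∀ x → x ∈ xs) → ∀ {n} (v : Vec A n) → v ∈ vectors xs n
  ∈-vectors x∈xs []      = here refl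
  ∈-vectors x∈xs (x ∷ v) = ∈-cartesianProductWith⁺ _∷_ (x∈xs x) (∈-vectors x∈xs v)

  vectors-unique : ∀ {xs} → Unique xs → ∀ n → Unique (vectors xs n)
  vectors-unique u zero    = [] ∷ []
  vectors-unique u (suc n) = Unique.cartesianProductWith⁺ _∷_ ∷-injective u (vectors-unique u n)

  -- Induction on `xs`, deleting one occurrence of its head from `ys`; uniqueness keeps the tail
  -- inside what is left.
  Unique-⊆⇒length≤ : ∀ {xs ys : List A} → Unique xs → xs ⊆ ys → length xs ≤ length ys
  Unique-⊆⇒length≤ []         xs⊆ys = z≤n
  Unique-⊆⇒length≤ {x ∷ xs} (x∉xs ∷ u) xs⊆ys with as , bs , refl ← ∈-∃++ (xs⊆ys (here refl)) = begin
    suc (length xs)              ≤⟨ s≤s (Unique-⊆⇒length≤ u rest) ⟩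
    suc (length (as ++ bs))      ≡⟨ cong suc (length-++ as) ⟩
    suc (length as + length bs)  ≡⟨ sym (+-suc (length as) (length bs)) ⟩
    length as + length (x ∷ bs)  ≡⟨ sym (length-++ as) ⟩
    length (as ++ x ∷ bs)        ∎
    where
    open ≤-Reasoning
    rest : xs ⊆ as ++ bs
    rest y∈xs with ∈-++⁻ as (xs⊆ys (there y∈xs))
    ... | inj₁ y∈as          = ∈-++⁺ˡ y∈as
    ... | inj₂ (here refl)   = contradiction refl (All.lookup x∉xs y∈xs)
    ... | inj₂ (there y∈bs)  = ∈-++⁺ʳ as y∈bs

  length-filter+filter-¬ : ∀ {P : A → Set} (P? : Decidable P) xs →
    length xs ≡ length (filter (¬? ∘ P?) xs) + length (filter P? xs)
  length-filter+filter-¬ P? []       = refl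
  length-filter+filter-¬ P? (x ∷ xs) with P? x
  ... | yes _ = trans (cong suc (length-filter+filter-¬ P? xs)) (sym (+-suc _ _))
  ... | no  _ = cong suc (length-filter+filter-¬ P? xs)

  length-concatMap≤ : ∀ {B : Set} (f : B → List A) c {xs} → All (λ x → length (f x) ≤ c) xs →
    length (concatMap f xs) ≤ length xs * c
  length-concatMap≤ f c []                    = z≤n
  length-concatMap≤ f c (_∷_ {x = x} le les) =
    ≤-trans (≤-reflexive (length-++ (f x))) (+-mono-≤ le (length-concatMap≤ f c les))

symbols : ∀ P → List (Symbol P)
symbols P = end ∷ map left (allFin P) ++ map right (allFin P)

∈-symbols : ∀ {P} (s : Symbol P) → s ∈ symbols P
∈-symbols end       = here refl
∈-symbols (left t)  = there (∈-++⁺ˡ (∈-map⁺ left (∈-allFin t)))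
∈-symbols (right t) = there (∈-++⁺ʳ (map left (allFin _)) (∈-map⁺ right (∈-allFin t)))

length-allFin : ∀ P → length (allFin P) ≡ P
length-allFin P = length-tabulate {n = P} id

length-symbols : ∀ ℓ → length (symbols (2 ^ ℓ)) ≤ 2 ^ (2 + ℓ)
length-symbols ℓ = begin
  suc (length (map left (allFin P) ++ map right (allFin P)))
    ≡⟨ cong suc (trans (length-++ (map left (allFin P)))
         (cong₂ _+_ (trans (length-map left (allFin P)) (length-allFin P))
                    (trans (length-map right (allFin P)) (length-allFin P)))) ⟩
  suc (P + P)        ≤⟨ +-monoˡ-≤ (P + P) (≤-trans (m^n>0 2 ℓ) (m≤m+n P P)) ⟩
  (P + P) + (P + P)  ≡⟨ regroup P ⟩
  2 ^ (2 + ℓ)        ∎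
  where
  open ≤-Reasoning
  P = 2 ^ ℓ
  regroup : ∀ p → (p + p) + (p + p) ≡ 2 * (2 * p)
  regroup = solve-∀

codes : ∀ n k P → List (Code n k P)
codes n k P = cartesianProduct ranks (cartesianProduct ranks
  (cartesianProduct (vectors ranks (suc k)) (vectors (symbols P) (7 * (n * k)))))
  where ranks = vectors (allFin P) n

∈-codes : ∀ {n k P} (c : Code n k P) → c ∈ codes n k P
∈-codes (ρ , σ , θ , w) = ∈-cartesianProduct⁺ (∈-vectors ∈-allFin ρ) (∈-cartesianProduct⁺ (∈-vectors ∈-allFin σ)
  (∈-cartesianProduct⁺ (∈-vectors (∈-vectors ∈-allFin) θ) (∈-vectors ∈-symbols w)))

-- Binary logarithm of a bound for the number of codes when `P = 2 ^ ℓ`: an entry of `Fin P` costs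
-- `ℓ` bits, and a symbol `2 + ℓ`, as there are 2P + 1 ≤ 4P symbols.
codeBits : ℕ → ℕ → ℕ → ℕ
codeBits n k ℓ = ℓ * n + (ℓ * n + (ℓ * n * suc k + (2 + ℓ) * (7 * (n * k))))

length-codes : ∀ n k ℓ → length (codes n k (2 ^ ℓ)) ≤ 2 ^ codeBits n k ℓ
length-codes n k ℓ = begin
  length (codes n k P)
    ≡⟨ trans (length-cartesianProductWith _,_ ranks _)
       (cong (length ranks *_) (trans (length-cartesianProductWith _,_ ranks _)
       (cong (length ranks *_) (length-cartesianProductWith _,_ (vectors ranks (suc k)) _)))) ⟩
  length ranks * (length ranks * (length (vectors ranks (suc k)) * length words))
    ≤⟨ *-mono-≤ ranks≤ (*-mono-≤ ranks≤ (*-mono-≤ rows≤ words≤)) ⟩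
  2 ^ a * (2 ^ a * (2 ^ b * 2 ^ c))
    ≡⟨ cong (λ z → 2 ^ a * (2 ^ a * z)) (sym (^-distribˡ-+-* 2 b c)) ⟩
  2 ^ a * (2 ^ a * 2 ^ (b + c))
    ≡⟨ cong (2 ^ a *_) (sym (^-distribˡ-+-* 2 a (b + c))) ⟩
  2 ^ a * 2 ^ (a + (b + c))
    ≡⟨ sym (^-distribˡ-+-* 2 a (a + (b + c))) ⟩
  2 ^ codeBits n k ℓ ∎
  where
  open ≤-Reasoning
  P     = 2 ^ ℓ
  a     = ℓ * n
  b     = ℓ * n * suc k
  c     = (2 + ℓ) * (7 * (n * k))
  ranks = vectors (allFin P) n
  words = vectors (symbols P) (7 * (n * k))

  ranks≡ : length ranks ≡ 2 ^ a
  ranks≡ = trans (length-vectors (allFin P) n) (trans (cong (_^ n) (length-allFin P)) (^-*-assoc 2 ℓ n))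

  ranks≤ = ≤-reflexive ranks≡

  rows≤ : length (vectors ranks (suc k)) ≤ 2 ^ b
  rows≤ = ≤-reflexive (trans (length-vectors ranks (suc k))
    (trans (cong (_^ suc k) ranks≡) (^-*-assoc 2 a (suc k))))

  words≤ : length words ≤ 2 ^ c
  words≤ = ≤-trans (≤-reflexive (length-vectors (symbols P) (7 * (n * k))))
    (≤-trans (^-monoˡ-≤ (7 * (n * k)) (length-symbols ℓ)) (≤-reflexive (^-*-assoc 2 (2 + ℓ) (7 * (n * k)))))

-- From representations to codes.

Table : ℕ → Set
Table n = Vec (Vec Bool n) n

-- Counting is done on tables because vectors, unlike functions, have decidable and extensional
-- equality.
toTable : ∀ {n} → BipGraph n → Table n
toTable G = Vec.tabulate λ i → Vec.tabulate (G i)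

toGraph : ∀ {n} → Table n → BipGraph n
toGraph T i j = Vec.lookup (Vec.lookup T i) j

toTable∘toGraph : ∀ {n} (T : Table n) → toTable (toGraph T) ≡ T
toTable∘toGraph T = trans (tabulate-cong λ i → tabulate∘lookup (Vec.lookup T i)) (tabulate∘lookup T)

-- An edge needs both differences to be at least `k`. The second code treats the difference in the
-- other direction, with the two sides exchanged, hence the arguments `j i`.
decodeTable : ∀ {n k P} → Code n k P × Code n k P → Table n
decodeTable (c , c′) = toTable λ i j → decode c i j ∧ decode c′ j i

tables : ∀ n k P → List (Table n)
tables n k P = map decodeTable (cartesianProduct (codes n k P) (codes n k P))

length-tables : ∀ n k ℓ → length (tables n k (2 ^ ℓ)) ≤ 2 ^ (codeBits n k ℓ + codeBits n k ℓ)
length-tables n k ℓ = begin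
  length (tables n k (2 ^ ℓ))
    ≡⟨ length-map decodeTable (cartesianProduct (codes n k (2 ^ ℓ)) (codes n k (2 ^ ℓ))) ⟩
  length (cartesianProduct (codes n k (2 ^ ℓ)) (codes n k (2 ^ ℓ)))
    ≡⟨ length-cartesianProductWith _,_ (codes n k (2 ^ ℓ)) (codes n k (2 ^ ℓ)) ⟩
  length (codes n k (2 ^ ℓ)) * length (codes n k (2 ^ ℓ))
    ≤⟨ *-mono-≤ (length-codes n k ℓ) (length-codes n k ℓ) ⟩
  2 ^ codeBits n k ℓ * 2 ^ codeBits n k ℓ
    ≡⟨ sym (^-distribˡ-+-* 2 (codeBits n k ℓ) (codeBits n k ℓ)) ⟩
  2 ^ (codeBits n k ℓ + codeBits n k ℓ) ∎
  where open ≤-Reasoning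

≡true⇔⇒≡does : ∀ {P : Set} {a} → a ≡ true ⇔ P → (P? : Dec P) → a ≡ does P?
≡true⇔⇒≡does         a⇔P (yes p) = Equivalence.from a⇔P p
≡true⇔⇒≡does {a = true}  a⇔P (no ¬p) = contradiction (Equivalence.to a⇔P refl) ¬p
≡true⇔⇒≡does {a = false} a⇔P (no ¬p) = refl

module _ {n k P : ℕ} (label : ℕ → Fin P) (toℕ-label : ∀ t → t ≤ suc n → toℕ (label t) ≡ t) where

  -- Vertices on one side are pairwise nonadjacent, which is the closeness required by `chain`; the
  -- edges across are then read off from two encodings.
  rep⇒codes : (G : BipGraph n) → HasMinDiffRep G k →
    ∃ λ (c : Code n k P × Code n k P) → toTable G ≡ decodeTable c
  rep⇒codes G (m , S , rep) = (c , c′) , tabulate-cong λ i → tabulate-cong λ j → G≡ i j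
    where
    A B : Fin n → Fin m → Bool
    A i = Vec.lookup (S (inj₁ i))
    B j = Vec.lookup (S (inj₂ j))

    ⊓≡ : ∀ u v → ∣ S u ─ S v ∣ ⊓ ∣ S v ─ S u ∣
      ≡ excess (Vec.lookup (S u)) (Vec.lookup (S v)) ⊓ excess (Vec.lookup (S v)) (Vec.lookup (S u))
    ⊓≡ u v = cong₂ _⊓_ (∣─∣≡excess (S u) (S v)) (∣─∣≡excess (S v) (S u))

    close : ∀ u v → u ≢ v → adj G u v ≡ false →
      excess (Vec.lookup (S u)) (Vec.lookup (S v)) ⊓ excess (Vec.lookup (S v)) (Vec.lookup (S u)) ≤ k
    close u v u≢v nonadj = ≤-trans (≤-reflexive (sym (⊓≡ u v)))
      (≰⇒≥ λ k≤ → contradiction (trans (sym nonadj) (Equivalence.from (rep u v u≢v) k≤)) λ ())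

    CA : Chain k A
    CA = chain A λ i j i≢j → close (inj₁ i) (inj₁ j) (i≢j ∘ inj₁-injective) refl

    CB : Chain k B
    CB = chain B λ i j i≢j → close (inj₂ i) (inj₂ j) (i≢j ∘ inj₂-injective) refl

    c c′ : Code n k P
    c  = proj₁ (encode label toℕ-label CA CB)
    c′ = proj₁ (encode label toℕ-label CB CA)

    G≡ : ∀ i j → G i j ≡ decode c i j ∧ decode c′ j i
    G≡ i j = trans (≡true⇔⇒≡does (mk⇔ to′ from′) ((k ≤? excess (A i) (B j)) ×-dec (k ≤? excess (B j) (A i))))
      (sym (cong₂ _∧_ (proj₂ (encode label toℕ-label CA CB) i j) (proj₂ (encode label toℕ-label CB CA) j i)))
      where
      open Equivalence (rep (inj₁ i) (inj₂ j) λ ())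
      to′ : G i j ≡ true → k ≤ excess (A i) (B j) × k ≤ excess (B j) (A i)
      to′ g = let k≤ = ≤-trans (to g) (≤-reflexive (⊓≡ (inj₁ i) (inj₂ j)))
              in m≤n⊓o⇒m≤n _ _ k≤ , m≤n⊓o⇒m≤o _ _ k≤
      from′ : k ≤ excess (A i) (B j) × k ≤ excess (B j) (A i) → G i j ≡ true
      from′ (k≤ , k≤′) = from (≤-trans (⊓-glb k≤ k≤′) (≤-reflexive (sym (⊓≡ (inj₁ i) (inj₂ j)))))

  rep⇒∈tables : ∀ T → HasMinDiffRep (toGraph T) k → T ∈ tables n k P
  rep⇒∈tables T rep = let (c , c′) , T≡ = rep⇒codes (toGraph T) rep in
    subst (_∈ tables n k P) (trans (sym T≡) (toTable∘toGraph T))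
      (∈-map⁺ decodeTable (∈-cartesianProduct⁺ (∈-codes c) (∈-codes c′)))

-- Counting the exceptional graphs

n≤2^n : ∀ n → n ≤ 2 ^ n
n≤2^n zero    = z≤n
n≤2^n (suc n) = ≤-trans (+-mono-≤ (m^n>0 2 n) (n≤2^n n)) (≤-reflexive (cong (2 ^ n +_) (sym (+-identityʳ (2 ^ n)))))

n<2^[1+⌊log₂n⌋] : ∀ n → n < 2 ^ suc ⌊log₂ n ⌋
n<2^[1+⌊log₂n⌋] n = ≰⇒> λ 2^≤n → 1+n≰n
  (≤-trans (≤-reflexive (sym (⌊log₂[2^n]⌋≡n (suc ⌊log₂ n ⌋)))) (⌊log₂⌋-mono-≤ 2^≤n))

module _ (n : ℕ) (2≤n : 2 ≤ n) where

  private
    lg = ⌊log₂ n ⌋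
    -- Since `suc n ≤ 2 ^ suc lg < 2 ^ (2 + lg)`, the labels 0, ..., n + 1 all fit into `Fin P`.
    ℓ  = 2 + lg
    P  = 2 ^ ℓ

    1≤lg : 1 ≤ lg
    1≤lg = ⌊log₂⌋-mono-≤ 2≤n

    instance
      P≢0 : NonZero P
      P≢0 = m^n≢0 2 ℓ

    label : ℕ → Fin P
    label t = t mod P

    toℕ-label : ∀ t → t ≤ suc n → toℕ (label t) ≡ t
    toℕ-label t t≤ = trans (toℕ-fromℕ< _) (m<n⇒m%n≡m (begin-strict
      t               ≤⟨ t≤ ⟩
      suc n           ≤⟨ n<2^[1+⌊log₂n⌋] n ⟩
      2 ^ suc lg      <⟨ ^-monoʳ-< 2 (s<s z<s) (n<1+n (suc lg)) ⟩
      P               ∎))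
      where open ≤-Reasoning

  -- The positive `k` that violate the lower bound with constant 1/96.
  Small : ℕ → Set
  Small k = 1 ≤ k × k * (96 * lg) < n

  Small? : ∀ k → Dec (Small k)
  Small? k = (1 ≤? k) ×-dec (k * (96 * lg) <? n)

  Small⇒<n : ∀ {k} → Small k → k < n
  Small⇒<n {k} (_ , k<) = ≤-<-trans (≤-trans (≤-reflexive (sym (*-identityʳ k)))
    (*-monoʳ-≤ k (*-mono-≤ {1} {96} (s≤s z≤n) 1≤lg))) k<

  Small⇒bits : ∀ {k} → Small k → codeBits n k ℓ + codeBits n k ℓ + (n + n) ≤ n * n
  Small⇒bits {k} (1≤k , k<) = ≤-trans (bound k lg 1≤k 1≤lg) (*-monoʳ-≤ n (<⇒≤ k<))
    where
    -- With k and log n shifted down by one, all coefficients of the difference are nonnegative.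
    identity : ∀ n k g →
      let b = (3 + g) * n + ((3 + g) * n + ((3 + g) * n * (2 + k) + (5 + g) * (7 * (n * (1 + k)))))
      in b + b + (n + n) + n * (20 * k + 74 * g + 80 * (k * g)) ≡ n * ((1 + k) * (96 * (1 + g)))
    identity = solve-∀

    bound : ∀ k g → 1 ≤ k → 1 ≤ g →
      codeBits n k (2 + g) + codeBits n k (2 + g) + (n + n) ≤ n * (k * (96 * g))
    bound (suc k) (suc g) _ _ = ≤-trans (m≤m+n _ _) (≤-reflexive (identity n k g))

  bad : List (Table n)
  bad = concatMap (λ k → tables n k P) (filter Small? (upTo n))

  rep⇒∈bad : ∀ {k} T → Small k → HasMinDiffRep (toGraph T) k → T ∈ bad
  rep⇒∈bad T small rep = ∈-concatMap⁺ (λ k → tables n k P) (lose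
    (∈-filter⁺ Small? (∈-upTo⁺ (Small⇒<n small)) small)
    (rep⇒∈tables label toℕ-label T rep))

  -- Both `r` and the number of small `k` are at most n ≤ 2^n, and each small `k` yields at most
  -- 2^(n² - 2n) tables.
  length-bad : ∀ r → r ≤ n → r * length bad ≤ 2 ^ (n * n)
  length-bad r r≤n = begin
    r * length bad            ≤⟨ *-mono-≤ (≤-trans r≤n (n≤2^n n)) bad≤ ⟩
    2 ^ n * (2 ^ n * 2 ^ L)   ≡⟨ cong (2 ^ n *_) (sym (^-distribˡ-+-* 2 n L)) ⟩
    2 ^ n * 2 ^ (n + L)       ≡⟨ sym (^-distribˡ-+-* 2 n (n + L)) ⟩
    2 ^ (n + (n + L))         ≡⟨ cong (2 ^_) (trans (sym (+-assoc n n L)) (m+[n∸m]≡n 2n≤n²)) ⟩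
    2 ^ (n * n)               ∎
    where
    open ≤-Reasoning
    L = n * n ∸ (n + n)

    2n≤n² : n + n ≤ n * n
    2n≤n² = ≤-trans (≤-reflexive (cong (n +_) (sym (+-identityʳ n)))) (*-monoˡ-≤ n 2≤n)

    ks = filter Small? (upTo n)

    ks≤ : length ks ≤ 2 ^ n
    ks≤ = ≤-trans (length-filter Small? (upTo n)) (≤-trans (≤-reflexive (length-upTo n)) (n≤2^n n))

    tables≤ : ∀ {k} → Small k → length (tables n k P) ≤ 2 ^ L
    tables≤ {k} small = ≤-trans (length-tables n k ℓ)
      (^-monoʳ-≤ 2 (m+n≤o⇒m≤o∸n (codeBits n k ℓ + codeBits n k ℓ) (Small⇒bits small)))

    bad≤ : length bad ≤ 2 ^ n * 2 ^ L
    bad≤ = ≤-trans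
      (length-concatMap≤ (λ k → tables n k P) (2 ^ L) (All.map tables≤ (All.all-filter Small? (upTo n))))
      (*-monoˡ-≤ (2 ^ L) ks≤)

  open DecMembership (≡-dec {n = n} (≡-dec {n = n} _≟ᵇ_)) using (_∈?_)

  allTables : List (Table n)
  allTables = vectors (vectors (false ∷ true ∷ []) n) n

  allTables-unique : Unique allTables
  allTables-unique = vectors-unique (vectors-unique (((λ ()) ∷ []) ∷ [] ∷ []) n) n

  length-allTables : length allTables ≡ 2 ^ (n * n)
  length-allTables = trans (length-vectors (vectors (false ∷ true ∷ []) n) n)
    (trans (cong (_^ n) (length-vectors (false ∷ true ∷ []) n)) (^-*-assoc 2 n n))

  good : List (Table n)
  good = filter (¬? ∘ (_∈? bad)) allTables

  length-good : 2 ^ (n * n) ≤ length good + length bad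
  length-good = begin
    2 ^ (n * n)       ≡⟨ sym length-allTables ⟩
    length allTables  ≡⟨ length-filter+filter-¬ (_∈? bad) allTables ⟩
    length good + length (filter (_∈? bad) allTables)
      ≤⟨ +-monoʳ-≤ (length good) (Unique-⊆⇒length≤ (Unique.filter⁺ (_∈? bad) allTables-unique)
           (λ T∈ → proj₂ (∈-filter⁻ (_∈? bad) {xs = allTables} T∈))) ⟩
    length good + length bad ∎
    where open ≤-Reasoning

  good-bound : ∀ {T} → T ∉ bad → FminLowerBound 1 96 (toGraph T)
  good-bound {T} T∉bad k 1≤k rep with 1 * n ≤? k * (96 * lg)
  ... | yes le = le
  ... | no ¬le = contradiction (rep⇒∈bad T (1≤k , ≤-trans (≰⇒> ¬le) (≤-reflexive (*-identityˡ n))) rep) T∉bad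

  goodGraphs : List (BipGraph n)
  goodGraphs = map toGraph good

  -- `toTable` is a left inverse of `toGraph`, so distinct tables give distinct graphs.
  goodGraphs-unique : Unique goodGraphs
  goodGraphs-unique = Unique.map⁺
    (λ {T} {U} eq → trans (sym (toTable∘toGraph T)) (trans (cong toTable eq) (toTable∘toGraph U)))
    (Unique.filter⁺ (¬? ∘ (_∈? bad)) allTables-unique)

  goodGraphs-bound : All (FminLowerBound 1 96) goodGraphs
  goodGraphs-bound = All.map⁺ (All.map good-bound (All.all-filter (¬? ∘ (_∈? bad)) allTables))

  -- With X the number of all graphs, `length-bad` bounds r times the number of bad tables by X.
  -- Hence rX is at most r times the number of good ones plus X, and one X cancels.
  length-goodGraphs : ∀ r → 1 ≤ r → r ≤ n → (r ∸ 1) * 2 ^ (n * n) ≤ r * length goodGraphs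
  length-goodGraphs (suc r) _ r≤n = +-cancelˡ-≤ X _ _ (begin
    suc r * X                                       ≤⟨ *-monoʳ-≤ (suc r) length-good ⟩
    suc r * (length good + length bad)              ≡⟨ *-distribˡ-+ (suc r) (length good) (length bad) ⟩
    suc r * length good + suc r * length bad        ≤⟨ +-monoʳ-≤ (suc r * length good) (length-bad (suc r) r≤n) ⟩
    suc r * length good + X                         ≡⟨ +-comm (suc r * length good) X ⟩
    X + suc r * length good                         ≡⟨ cong (λ l → X + suc r * l) (sym (length-map toGraph good)) ⟩
    X + suc r * length goodGraphs                   ∎)
    where
    open ≤-Reasoning
    X = 2 ^ (n * n)

theorem2 : Σ ℕ λ p → Σ ℕ λ q → 1 ≤ p × 1 ≤ q ×
    ((r : ℕ) → 1 ≤ r → Σ ℕ λ N → (n : ℕ) → N ≤ n →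
    Σ (List (BipGraph n)) λ Gs →
    Unique Gs × All (FminLowerBound p q) Gs ×
    (r ∸ 1) * (2 ^ (n * n)) ≤ r * length Gs)
-- `N = 2 + r` ensures both `2 ≤ n`, which makes the logarithm positive, and `r ≤ n`, which
-- `length-bad` requires.
theorem2 = 1 , 96 , ≤-refl , s≤s z≤n , λ r 1≤r → 2 + r , λ n 2+r≤n →
  let 2≤n = m+n≤o⇒m≤o 2 2+r≤n
  in goodGraphs n 2≤n , goodGraphs-unique n 2≤n , goodGraphs-bound n 2≤n ,
     length-goodGraphs n 2≤n r 1≤r (m+n≤o⇒n≤o 2 2+r≤n)
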